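{- For every integer $n\ge 1$, $$\mathrm{pf}_n(132,213,231)=\mathrm{pf}_n(132,231,312)=\sum_{i=1}^n C_i,$$ where $C_i=\frac{1}{i+1}\binom{2i}{i}$ is the $i$th Catalan number.
   Context: A Dyck path of semilength $n$ is a lattice path from $(0,0)$ to $(n,n)$ consisting of $n$ north steps $N=(0,1)$ and $n$ east steps $E=(1,0)$ that never goes below the line $y=x$. A parking function of size $n$ is a Dyck path of semilength $n$ whose $n$ north steps are labeled bijectively by $\{1,\dots,n\}$ so that whenever two north steps are consecutive in the path (one immediately following the other), the label of the later one is larger. For a parking function $p$ of size $n$, $\phi(p)$ is the permutation of $\{1,\dots,n\}$ (in one-line notation) obtained by reading the labels of the north steps in the order they occur along the path. A permutation $\pi$ of $\{1,\dots,n\}$ contains a permutation $\rho$ of $\{1,\dots,m\}$ if there are indices $1\le i_1<\cdots<i_m\le n$ such that $\pi_{i_a}\le\pi_{i_b}$ if and only if $\rho_a\le\rho_b$; otherwise $\pi$ avoids $\rho$. For permutations $\rho_1,\dots,\rho_r$, $\mathrm{pf}_n(\rho_1,\dots,\rho_r)$ denotes the number of parking functions $p$ of size $n$ such that $\phi(p)$ avoids each of $\rho_1,\dots,\rho_r$. -}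

module Defs where

open import Data.Fin as Fin using (Fin)
open import Data.Fin.Patterns using (0F; 1F; 2F)
import Data.Fin.Properties as Fin
open import Data.List using (List; []; _∷_; map; mapMaybe; filter; length; lookup; inits; allFin; cartesianProductWith; applyUpTo)
open import Data.List.Membership.Propositional using (_∈_)
import Data.List.Membership.DecPropositional as DecMembership
open import Data.List.Relation.Unary.All using (All; all?)
open import Data.List.Relation.Unary.Linked using (Linked; linked?)
open import Data.List.Relation.Unary.Unique.Propositional using (Unique)
import Data.List.Relation.Unary.Unique.DecPropositional as DecUnique
open import Data.Maybe using (Maybe; just; nothing)
open import Data.Nat using (ℕ; zero; suc; _+_; _*_; _/_; _≤_; _≤?_; _≟_)
open import Data.Nat.Combinatorics using (_C_)
open import Data.Nat.ListAction using (sum)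
open import Data.Product using (∃; _×_; _,_; proj₁; proj₂)
open import Data.Product.Properties using (≡-dec)
open import Data.Unit using (⊤; tt)
open import Data.Vec as Vec using (Vec; []; _∷_)
open import Function using (_∘_; _⇔_; mk⇔; Equivalence)
open import Level using (0ℓ)
open import Relation.Binary as B using (Rel)
open import Relation.Binary.PropositionalEquality using (_≡_)
open import Relation.Nullary using (Dec; yes; no; ¬_; ¬?)
open import Relation.Nullary.Decidable using (map′; _×-dec_; _→-dec_; True; toWitness)
open import Relation.Unary as U using (Pred)

data Step : Set where
  N E : Step

Path : Set
Path = List Step

-- The lattice point reached from (0 , 0).

endpoint : Path → ℕ × ℕ
endpoint []      = 0 , 0
endpoint (N ∷ w) = let x , y = endpoint w in x , suc y
endpoint (E ∷ w) = let x , y = endpoint w in suc x , y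

-- A lattice path stays weakly above y = x exactly when its vertices, the
-- endpoints of its prefixes, do.

WeaklyAboveDiagonal : ℕ × ℕ → Set
WeaklyAboveDiagonal (x , y) = x ≤ y

IsDyckPath : ℕ → Path → Set
IsDyckPath n w =
  endpoint w ≡ (n , n) × All (WeaklyAboveDiagonal ∘ endpoint) (inits w)

isDyckPath? : ∀ n → U.Decidable (IsDyckPath n)
isDyckPath? n w =
  ≡-dec _≟_ _≟_ (endpoint w) (n , n)
    ×-dec all? (λ u → proj₁ (endpoint u) ≤? proj₂ (endpoint u)) (inits w)

-- In one-line notation, Fin n plays the role of {1, …, n}, with i : Fin n standing for the
-- number toℕ i + 1.

IsPermutation : ∀ {n} → List (Fin n) → Set
IsPermutation {n} π = Unique π × (∀ i → i ∈ π)

isPermutation? : ∀ {n} → U.Decidable (IsPermutation {n})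
isPermutation? π =
  DecUnique.unique? Fin._≟_ π
    ×-dec Fin.all? (λ i → DecMembership._∈?_ Fin._≟_ i π)

record Perm : Set where
  constructor perm
  field
    {size}        : ℕ
    oneLine       : List (Fin size)
    isPermutation : IsPermutation oneLine

open Perm public

fromOneLine : ∀ m (π : List (Fin m)) {_ : True (isPermutation? π)} → Perm
fromOneLine m π {p} = perm π (toWitness p)

[132] [213] [231] [312] : Perm
[132] = fromOneLine 3 (0F ∷ 2F ∷ 1F ∷ [])
[213] = fromOneLine 3 (1F ∷ 0F ∷ 2F ∷ [])
[231] = fromOneLine 3 (1F ∷ 2F ∷ 0F ∷ [])
[312] = fromOneLine 3 (2F ∷ 0F ∷ 1F ∷ [])

record IsOccurrence {n m} (π : List (Fin n)) (ρ : List (Fin m))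
                    (is : Vec (Fin (length π)) (length ρ)) : Set where
  constructor occurrence
  field
    increasing : ∀ a b → a Fin.< b → Vec.lookup is a Fin.< Vec.lookup is b
    sameOrder  : ∀ a b →
                 lookup π (Vec.lookup is a) Fin.≤ lookup π (Vec.lookup is b)
                   ⇔ lookup ρ a Fin.≤ lookup ρ b

Contains : ∀ {n} → List (Fin n) → Perm → Set
Contains π ρ = ∃ (IsOccurrence π (oneLine ρ))

Avoids : ∀ {n} → List (Fin n) → Perm → Set
Avoids π ρ = ¬ Contains π ρ

private
  _⇔-dec_ : ∀ {A B : Set} → Dec A → Dec B → Dec (A ⇔ B)
  a? ⇔-dec b? =
    map′ (λ (f , g) → mk⇔ f g)
         (λ e → Equivalence.to e , Equivalence.from e)
         ((a? →-dec b?) ×-dec (b? →-dec a?))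

  anyVec? : ∀ {n} k {P : Pred (Vec (Fin n) k) 0ℓ} → U.Decidable P → Dec (∃ P)
  anyVec? zero    P? = map′ (λ p → [] , p) (λ { ([] , p) → p }) (P? [])
  anyVec? (suc k) P? =
    map′ (λ (i , is , p) → i ∷ is , p) (λ { (i ∷ is , p) → i , is , p })
         (Fin.any? λ i → anyVec? k λ is → P? (i ∷ is))

isOccurrence? : ∀ {n m} (π : List (Fin n)) (ρ : List (Fin m)) →
                U.Decidable (IsOccurrence π ρ)
isOccurrence? π ρ is =
  map′ (λ (i , s) → occurrence i s)
       (λ o → IsOccurrence.increasing o , IsOccurrence.sameOrder o)
       ((Fin.all? λ a → Fin.all? λ b →
           (a Fin.<? b) →-dec (Vec.lookup is a Fin.<? Vec.lookup is b))
        ×-dec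
        (Fin.all? λ a → Fin.all? λ b →
           (lookup π (Vec.lookup is a) Fin.≤? lookup π (Vec.lookup is b))
             ⇔-dec (lookup ρ a Fin.≤? lookup ρ b)))

avoids? : ∀ {n} (π : List (Fin n)) → U.Decidable (Avoids π)
avoids? π ρ = ¬? (anyVec? _ (isOccurrence? π (oneLine ρ)))

data LabelledStep (n : ℕ) : Set where
  N : Fin n → LabelledStep n
  E : LabelledStep n

LabelledPath : ℕ → Set
LabelledPath n = List (LabelledStep n)

forget : ∀ {n} → LabelledStep n → Step
forget (N _) = N
forget E     = E

label : ∀ {n} → LabelledStep n → Maybe (Fin n)
label (N i) = just i
label E     = nothing

φ : ∀ {n} → LabelledPath n → List (Fin n)
φ = mapMaybe label

NorthLabelsIncrease : ∀ {n} → Rel (LabelledStep n) 0ℓ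
NorthLabelsIncrease (N i) (N j) = i Fin.< j
NorthLabelsIncrease _     _     = ⊤

northLabelsIncrease? : ∀ {n} → B.Decidable (NorthLabelsIncrease {n})
northLabelsIncrease? (N i) (N j) = i Fin.<? j
northLabelsIncrease? (N _) E     = yes tt
northLabelsIncrease? E     _     = yes tt

record IsParkingFunction (n : ℕ) (p : LabelledPath n) : Set where
  constructor parkingFunction
  field
    isDyckPath : IsDyckPath n (map forget p)
    bijective  : IsPermutation (φ p)
    columns    : Linked NorthLabelsIncrease p

isParkingFunction? : ∀ n → U.Decidable (IsParkingFunction n)
isParkingFunction? n p =
  map′ (λ (d , b , c) → parkingFunction d b c)
       (λ q → let open IsParkingFunction q in isDyckPath , bijective , columns)
       (isDyckPath? n (map forget p)
         ×-dec isPermutation? (φ p)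
         ×-dec linked? northLabelsIncrease? p)

-- All words of length k over the letters of as; no word is repeated when
-- the letters are distinct.

words : ∀ {A : Set} → List A → (k : ℕ) → List (List A)
words as zero    = [] ∷ []
words as (suc k) = cartesianProductWith _∷_ as (words as k)

labelledSteps : ∀ n → List (LabelledStep n)
labelledSteps n = E ∷ map N (allFin n)

-- A Dyck path of semilength n has exactly n + n steps, so every parking
-- function of size n occurs exactly once.

parkingFunctions : ∀ n → List (LabelledPath n)
parkingFunctions n =
  filter (isParkingFunction? n) (words (labelledSteps n) (n + n))

pf : ℕ → List Perm → ℕ
pf n ρs = length (filter (λ p → all? (avoids? (φ p)) ρs) (parkingFunctions n))

-- suc i always divides (2 * i) C i, so the floor division is exact.

catalan : ℕ → ℕ
catalan i = ((2 * i) C i) / suc i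

∑[1⋯_] : ℕ → (ℕ → ℕ) → ℕ
∑[1⋯ n ] f = sum (applyUpTo (f ∘ suc) n)

{-# OPTIONS --safe #-}

-- A permutation avoiding 132 and 231 decreases down to its minimum and then increases. Avoiding
-- 213 as well puts everything before the minimum above everything after it, while avoiding 312
-- puts it below. So, writing 1 2 … n as us vs with us non-empty, the two classes consist of the n
-- permutations vsʳ us (skew) and usʳ vs (layer) respectively. In either class there is exactly
-- one permutation with j descents for each j < n, and all of them come first. Since the labels
-- increase along runs of north steps, every descent forces an east step, and on the diagonal this
-- means that the path starts with j copies of N E; what follows is an arbitrary Dyck path of
-- semilength n - j.

module Submission where

open import Defs
open import Data.Fin as Fin using (Fin)
open import Data.Fin.Patterns using (0F; 1F; 2F)
import Data.Fin.Properties as Fin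
open import Data.Empty using (⊥)
open import Data.List using (List; []; _∷_; _++_; map; length; inits; lookup; reverse; allFin; take; drop; concat; filter; applyUpTo)
open import Data.List.Properties using (∷-injectiveʳ; length-++; length-map; length-take; length-drop; length-reverse; length-tabulate; unfold-reverse; reverse-involutive; tabulate-lookup; take++drop≡id; ∷ʳ-++)
open import Data.List.Membership.Propositional using (_∈_)
open import Data.List.Membership.Propositional.Properties using (∈-map⁺; ∈-map⁻; ∈-++⁺ˡ; ∈-++⁺ʳ; ∈-++⁻; ∈-filter⁺; ∈-filter⁻; ∈-lookup; ∈-allFin; ∈-applyUpTo⁺; ∈-applyUpTo⁻; ∈-concat⁺′; ∈-concat⁻′; ∈-cartesianProductWith⁺)
open import Data.List.Membership.Propositional.Properties.WithK using (unique∧set⇒bag)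
open import Data.List.Relation.Binary.BagAndSetEquality using (∼bag⇒↭)
open import Data.List.Relation.Binary.Disjoint.Propositional using (Disjoint)
open import Data.List.Relation.Binary.Permutation.Propositional using (_↭_; ↭-sym; ↭-reflexive; ↭-trans; ↭⇒↭ₛ)
open import Data.List.Relation.Binary.Permutation.Propositional.Properties using (All-resp-↭; ∈-resp-↭; ↭-reverse; ↭-length; ++⁺ˡ; ++⁺ʳ; ++-comm)
import Data.List.Relation.Binary.Permutation.Setoid.Properties as Permutationₛ
open import Data.List.Relation.Binary.Pointwise using (Pointwise-≡⇒≡)
open import Data.List.Relation.Unary.All as All using (All; []; _∷_)
import Data.List.Relation.Unary.All.Properties as All
open import Data.List.Relation.Unary.AllPairs as AllPairs using (AllPairs; []; _∷_)
import Data.List.Relation.Unary.AllPairs.Properties as AllPairs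
open import Data.List.Relation.Unary.Any using (here; there)
open import Data.List.Relation.Unary.Linked as Linked using (Linked; []; [-]; _∷_)
open import Data.List.Relation.Unary.Linked.Properties using (AllPairs⇒Linked)
open import Data.List.Relation.Unary.Sorted.TotalOrder.Properties using (↗↭↗⇒≋)
open import Data.List.Relation.Unary.Unique.Propositional using (Unique)
import Data.List.Relation.Unary.Unique.Propositional.Properties as Unique
open import Data.Nat
open import Data.Nat.Combinatorics using (_C_; nC1≡n; nCk≡nC[n∸k]; nCk+nC[k+1]≡[n+1]C[k+1])
open import Data.Nat.DivMod using (m*n/n≡m)
open import Data.Nat.ListAction using (sum)
open import Data.Nat.Properties
open import Data.Nat.Tactic.RingSolver using (solve-∀)
open import Data.Product using (∃; ∃₂; _×_; _,_; proj₁; proj₂; map₁; uncurry)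
open import Data.Sum using (inj₁; inj₂; [_,_]′)
open import Data.Unit using (⊤; tt)
open import Data.Vec as Vec using (Vec; []; _∷_)
open import Data.Vec.Properties using (lookup-map)
open import Function using (_∘_; _⇔_; case_of_; flip; mk⇔; Equivalence)
open import Level using (0ℓ)
open import Relation.Binary using (Rel; tri<; tri≈; tri>)
open import Relation.Binary.PropositionalEquality
open import Relation.Nullary using (¬_; Dec; contradiction)
open import Relation.Nullary.Decidable using (True; toWitness)
open import Relation.Unary using (Pred)

-- Ballot numbers and Catalan numbers

-- The ratio of neighbouring binomial coefficients in a row, with `n - k` moved across to avoid
-- truncated subtraction. Pascal's rule on both coefficients gives the induction on `n`.
absorption : ∀ n k → suc k * (n C suc k) + k * (n C k) ≡ n * (n C k)
absorption n zero = begin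
  1 * (n C 1) + 0  ≡⟨ cong (λ c → 1 * c + 0) (nC1≡n n) ⟩
  1 * n + 0      ≡⟨ trans (+-identityʳ (1 * n)) (*-comm 1 n) ⟩
  n * 1          ∎
  where open ≡-Reasoning
absorption zero (suc k) = cong₂ _+_ (*-zeroʳ (suc (suc k))) (*-zeroʳ (suc k))
absorption (suc n) (suc k) = begin
  (2 + k) * (suc n C (2 + k)) + suc k * (suc n C suc k)
    ≡⟨ cong₂ (λ a b → (2 + k) * a + suc k * b)
         (nCk+nC[k+1]≡[n+1]C[k+1] n (suc k)) (nCk+nC[k+1]≡[n+1]C[k+1] n k) ⟨
  (2 + k) * (b + c) + suc k * (a + b)
    ≡⟨ expand k a b c ⟩
  ((2 + k) * c + suc k * b) + (suc k * b + k * a) + (a + b)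
    ≡⟨ cong₂ (λ x y → x + y + (a + b)) (absorption n (suc k)) (absorption n k) ⟩
  n * b + n * a + (a + b)
    ≡⟨ collect n a b ⟩
  suc n * (a + b)
    ≡⟨ cong (suc n *_) (nCk+nC[k+1]≡[n+1]C[k+1] n k) ⟩
  suc n * (suc n C suc k) ∎
  where
  open ≡-Reasoning
  a b c : ℕ
  a = n C k
  b = n C suc k
  c = n C (2 + k)

  expand : ∀ k a b c → (2 + k) * (b + c) + suc k * (a + b) ≡
                       ((2 + k) * c + suc k * b) + (suc k * b + k * a) + (a + b)
  expand = solve-∀

  collect : ∀ n a b → n * b + n * a + (a + b) ≡ suc n * (a + b)
  collect = solve-∀

-- Paths to the diagonal from h units above it, with m north steps left.

ballot : ℕ → ℕ → ℕ
ballot zero    h       = 1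
ballot (suc m) zero    = ballot m 1
ballot (suc m) (suc h) = ballot m (2 + h) + ballot (suc m) h

-- n C (k - 1), with the untruncated k - 1.

_C⁻_ : ℕ → ℕ → ℕ
n C⁻ zero  = 0
n C⁻ suc k = n C k

infixl 6.5 _C⁻_

pascal⁻ : ∀ n k → n C⁻ k + n C k ≡ suc n C k
pascal⁻ n zero    = refl
pascal⁻ n (suc k) = nCk+nC[k+1]≡[n+1]C[k+1] n k

-- The reflection principle, with the bad paths moved to the left.

ballot-reflection : ∀ m h {n} → n ≡ m + m + h → ballot m h + n C⁻ m ≡ n C m
ballot-reflection zero h refl = refl
ballot-reflection (suc m) zero {n} refl = begin
  ballot m 1 + n C m
    ≡⟨ cong (λ c → ballot m 1 + c) (pascal⁻ n′ m) ⟨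
  ballot m 1 + (n′ C⁻ m + n′ C m)
    ≡⟨ +-assoc (ballot m 1) _ _ ⟨
  ballot m 1 + n′ C⁻ m + n′ C m
    ≡⟨ cong (_+ n′ C m) (ballot-reflection m 1 (n′≡m+m+1 m)) ⟩
  n′ C m + n′ C m
    ≡⟨ cong (n′ C m +_) middle ⟩
  n′ C m + n′ C suc m
    ≡⟨ nCk+nC[k+1]≡[n+1]C[k+1] n′ m ⟩
  n C suc m ∎
  where
  open ≡-Reasoning
  n′ : ℕ
  n′ = m + suc m + 0

  n′≡m+m+1 : ∀ m → m + suc m + 0 ≡ m + m + 1
  n′≡m+m+1 = solve-∀

  -- The two central entries of the odd row `n′ = 2m + 1` agree. In the reflection formula this says
  -- that an east step below the diagonal would contribute 0.
  middle : n′ C m ≡ n′ C suc m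
  middle = trans (nCk≡nC[n∸k] (≤-trans (m≤m+n m (suc m)) (m≤m+n _ 0)))
                 (cong (n′ C_) (trans (cong (_∸ m) (+-identityʳ (m + suc m))) (m+n∸m≡n m (suc m))))
ballot-reflection (suc m) (suc h) {n} refl = begin
  b₁ + b₂ + n C m
    ≡⟨ cong (b₁ + b₂ +_) (cong (_C m) n≡1+n′) ⟩
  b₁ + b₂ + suc n′ C m
    ≡⟨ cong (b₁ + b₂ +_) (pascal⁻ n′ m) ⟨
  b₁ + b₂ + (n′ C⁻ m + n′ C m)
    ≡⟨ interchange b₁ b₂ (n′ C⁻ m) (n′ C m) ⟩
  (b₁ + n′ C⁻ m) + (b₂ + n′ C m)
    ≡⟨ cong₂ _+_ (ballot-reflection m (2 + h) (n′≡m+m+[2+h] m h)) (ballot-reflection (suc m) h refl) ⟩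
  n′ C m + n′ C suc m
    ≡⟨ nCk+nC[k+1]≡[n+1]C[k+1] n′ m ⟩
  suc n′ C suc m
    ≡⟨ cong (_C suc m) n≡1+n′ ⟨
  n C suc m ∎
  where
  open ≡-Reasoning
  b₁ b₂ n′ : ℕ
  b₁ = ballot m (2 + h)
  b₂ = ballot (suc m) h
  n′ = suc m + suc m + h

  n≡1+n′ : suc m + suc m + suc h ≡ suc n′
  n≡1+n′ = +-suc (suc m + suc m) h

  n′≡m+m+[2+h] : ∀ m h → suc m + suc m + h ≡ m + m + (2 + h)
  n′≡m+m+[2+h] = solve-∀

  interchange : ∀ a b c d → a + b + (c + d) ≡ (a + c) + (b + d)
  interchange = solve-∀

-- The reflection formula multiplied by `m + 1`: since `below-middle` trades the subtracted
-- coefficient for a multiple of the central one, the product is exactly the central coefficient and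
-- the floor division loses nothing.
ballot-catalan : ∀ m → ballot m 0 ≡ catalan m
ballot-catalan m = begin
  ballot m 0                   ≡⟨ m*n/n≡m (ballot m 0) (suc m) ⟨
  ballot m 0 * suc m / suc m   ≡⟨ cong (_/ suc m) (+-cancelʳ-≡ _ (ballot m 0 * suc m) _ key) ⟩
  (n C m) / suc m              ∎
  where
  open ≡-Reasoning
  n : ℕ
  n = 2 * m

  n≡m+m+0 : ∀ m → 2 * m ≡ m + m + 0
  n≡m+m+0 = solve-∀

  below-middle : ∀ m → suc m * ((2 * m) C⁻ m) ≡ m * ((2 * m) C m)
  below-middle zero    = refl
  -- Adding `m * c` to both sides makes the right-hand side an instance of `absorption`.
  below-middle (suc m) = +-cancelʳ-≡ (m * c) _ _ (begin
    (2 + m) * c + m * c                      ≡⟨ double m c ⟩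
    2 * suc m * c                            ≡⟨ absorption (2 * suc m) m ⟨
    suc m * ((2 * suc m) C suc m) + m * c    ∎)
    where
    c : ℕ
    c = (2 * suc m) C m

    double : ∀ m c → (2 + m) * c + m * c ≡ 2 * suc m * c
    double = solve-∀

  distribute : ∀ b c m → b * suc m + suc m * c ≡ suc m * (b + c)
  distribute = solve-∀

  key : ballot m 0 * suc m + m * (n C m) ≡ n C m + m * (n C m)
  key = begin
    ballot m 0 * suc m + m * (n C m)         ≡⟨ cong (ballot m 0 * suc m +_) (below-middle m) ⟨
    ballot m 0 * suc m + suc m * (n C⁻ m)    ≡⟨ distribute (ballot m 0) (n C⁻ m) m ⟩
    suc m * (ballot m 0 + n C⁻ m)            ≡⟨ cong (suc m *_) (ballot-reflection m 0 (n≡m+m+0 m)) ⟩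
    n C m + m * (n C m)                      ∎

-- Dyck paths as a recursive condition

-- The Dyck condition with the height above the diagonal as its only state. `IsDyckPath` inspects
-- all prefixes instead, which does not suit induction on the steps.
Ballot : ℕ → Path → Set
Ballot h       (N ∷ w) = Ballot (suc h) w
Ballot zero    (E ∷ w) = ⊥
Ballot (suc h) (E ∷ w) = Ballot h w
Ballot zero    []      = ⊤
Ballot (suc h) []      = ⊥

-- `endpoint` is measured from the start of `w`, so the initial height appears as the summand `h`;
-- at `h = 0` this is the Dyck condition.
Ballot⇒aboveDiagonal : ∀ h w → Ballot h w →
  proj₁ (endpoint w) ≡ h + proj₂ (endpoint w) ×
  All (λ u → proj₁ (endpoint u) ≤ h + proj₂ (endpoint u)) (inits w)
Ballot⇒aboveDiagonal zero    []      _ = refl , z≤n ∷ []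
Ballot⇒aboveDiagonal h       (N ∷ w) b with end , above ← Ballot⇒aboveDiagonal (suc h) w b =
  trans end (sym (+-suc h _)) ,
  z≤n ∷ All.map⁺ (All.map (λ {u} x≤ → subst (proj₁ (endpoint u) ≤_) (sym (+-suc h _)) x≤) above)
Ballot⇒aboveDiagonal (suc h) (E ∷ w) b with end , above ← Ballot⇒aboveDiagonal h w b =
  cong suc end , z≤n ∷ All.map⁺ (All.map s≤s above)

aboveDiagonal⇒Ballot : ∀ h w → proj₁ (endpoint w) ≡ h + proj₂ (endpoint w) →
  All (λ u → proj₁ (endpoint u) ≤ h + proj₂ (endpoint u)) (inits w) → Ballot h w
aboveDiagonal⇒Ballot zero    []      _   _           = tt
aboveDiagonal⇒Ballot h       (N ∷ w) end (_ ∷ above) =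
  aboveDiagonal⇒Ballot (suc h) w (trans end (+-suc h _))
    (All.map (λ {u} x≤ → subst (proj₁ (endpoint u) ≤_) (+-suc h _) x≤) (All.map⁻ above))
-- The second prefix is the single step `E`, which already ends below the diagonal.
aboveDiagonal⇒Ballot zero    (E ∷ w) end (_ ∷ () ∷ _)
aboveDiagonal⇒Ballot (suc h) (E ∷ w) end (_ ∷ above) =
  aboveDiagonal⇒Ballot h w (suc-injective end) (All.map s≤s⁻¹ (All.map⁻ above))

-- Paths with a prescribed label sequence

module _ {n : ℕ} where

  norths : ∀ (p : LabelledPath n) → proj₂ (endpoint (map forget p)) ≡ length (φ p)
  norths []        = refl
  norths (N _ ∷ p) = cong suc (norths p)
  norths (E ∷ p)   = norths p

  -- The labels still to be placed stand in for the number of north steps left in `ballot`. The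
  -- column condition is left out, being automatic when the labels increase.
  labelledBallots : List (Fin n) → ℕ → List (LabelledPath n)
  labelledBallots []      zero    = [] ∷ []
  labelledBallots []      (suc h) = map (E ∷_) (labelledBallots [] h)
  labelledBallots (a ∷ π) zero    = map (N a ∷_) (labelledBallots π 1)
  labelledBallots (a ∷ π) (suc h) =
    map (N a ∷_) (labelledBallots π (2 + h)) ++ map (E ∷_) (labelledBallots (a ∷ π) h)

  length-labelledBallots : ∀ π h → length (labelledBallots π h) ≡ ballot (length π) h
  length-labelledBallots []      zero    = refl
  length-labelledBallots []      (suc h) =
    trans (length-map _ (labelledBallots [] h)) (length-labelledBallots [] h)
  length-labelledBallots (a ∷ π) zero    =
    trans (length-map _ (labelledBallots π 1)) (length-labelledBallots π 1)
  length-labelledBallots (a ∷ π) (suc h) = trans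
    (length-++ (map (N a ∷_) (labelledBallots π (2 + h))))
    (cong₂ _+_
      (trans (length-map _ (labelledBallots π (2 + h))) (length-labelledBallots π (2 + h)))
      (trans (length-map _ (labelledBallots (a ∷ π) h)) (length-labelledBallots (a ∷ π) h)))

  labelledBallots-unique : ∀ π h → Unique (labelledBallots π h)
  labelledBallots-unique []      zero    = [] ∷ []
  labelledBallots-unique []      (suc h) = Unique.map⁺ ∷-injectiveʳ (labelledBallots-unique [] h)
  labelledBallots-unique (a ∷ π) zero    = Unique.map⁺ ∷-injectiveʳ (labelledBallots-unique π 1)
  labelledBallots-unique (a ∷ π) (suc h) = Unique.++⁺
    (Unique.map⁺ ∷-injectiveʳ (labelledBallots-unique π (2 + h)))
    (Unique.map⁺ ∷-injectiveʳ (labelledBallots-unique (a ∷ π) h))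
    λ (∈N , ∈E) → case ∈-map⁻ (N a ∷_) ∈N , ∈-map⁻ (E ∷_) ∈E of λ where
      ((_ , _ , refl) , (_ , _ , ()))

  ∈-labelledBallots⁺ : ∀ p h → Ballot h (map forget p) → p ∈ labelledBallots (φ p) h
  ∈-labelledBallots⁺ []        zero    b = here refl
  ∈-labelledBallots⁺ (N a ∷ p) zero    b = ∈-map⁺ _ (∈-labelledBallots⁺ p 1 b)
  ∈-labelledBallots⁺ (N a ∷ p) (suc h) b = ∈-++⁺ˡ (∈-map⁺ _ (∈-labelledBallots⁺ p (2 + h) b))
  -- The case of a first step `E` is spread over two clauses of `labelledBallots`, according to
  -- whether any label is left.
  ∈-labelledBallots⁺ (E ∷ p)   (suc h) b with φ p | ∈-labelledBallots⁺ p h b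
  ... | []    | p∈ = ∈-map⁺ _ p∈
  ... | a ∷ π | p∈ = ∈-++⁺ʳ (map (N a ∷_) (labelledBallots π (2 + h))) (∈-map⁺ _ p∈)

  ∈-labelledBallots⁻ : ∀ π h {p} → p ∈ labelledBallots π h → φ p ≡ π × Ballot h (map forget p)
  ∈-labelledBallots⁻ []      zero    (here refl) = refl , tt
  ∈-labelledBallots⁻ []      (suc h) p∈ with _ , q∈ , refl ← ∈-map⁻ _ p∈ = ∈-labelledBallots⁻ [] h q∈
  ∈-labelledBallots⁻ (a ∷ π) zero    p∈ with _ , q∈ , refl ← ∈-map⁻ _ p∈ =
    map₁ (cong (a ∷_)) (∈-labelledBallots⁻ π 1 q∈)
  ∈-labelledBallots⁻ (a ∷ π) (suc h) p∈ with ∈-++⁻ (map (N a ∷_) (labelledBallots π (2 + h))) p∈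
  ... | inj₁ p∈N with _ , q∈ , refl ← ∈-map⁻ _ p∈N =
    map₁ (cong (a ∷_)) (∈-labelledBallots⁻ π (2 + h) q∈)
  ... | inj₂ p∈E with _ , q∈ , refl ← ∈-map⁻ _ p∈E = ∈-labelledBallots⁻ (a ∷ π) h q∈

  linked-E∷ : ∀ {p : LabelledPath n} → Linked NorthLabelsIncrease p → Linked NorthLabelsIncrease (E ∷ p)
  linked-E∷ []            = [-]
  linked-E∷ [-]           = tt ∷ [-]
  linked-E∷ (r ∷ linked)  = tt ∷ r ∷ linked

  -- Consecutive north steps carry neighbouring entries of `φ p`, so after the last descent every
  -- Dyck path is admissible.
  increasing⇒columns : ∀ p → Linked Fin._<_ (φ p) → Linked NorthLabelsIncrease p
  increasing⇒columns []              _          = []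
  increasing⇒columns (E ∷ p)         inc        = linked-E∷ (increasing⇒columns p inc)
  increasing⇒columns (N a ∷ [])      _          = [-]
  increasing⇒columns (N a ∷ N b ∷ p) (a<b ∷ inc) = a<b ∷ increasing⇒columns (N b ∷ p) inc
  increasing⇒columns (N a ∷ E ∷ p)   inc        = tt ∷ increasing⇒columns (E ∷ p) (Linked.tail inc)

  -- Label sequences that decrease and then increase

  -- The index counts the descents, and hence the copies of `N E` that are forced at the start of a
  -- path.
  data Valley : ℕ → List (Fin n) → Set where
    ascent  : ∀ {a π} → Linked Fin._<_ (a ∷ π) → Valley 0 (a ∷ π)
    descent : ∀ {j a b π} → b Fin.< a → Valley j (b ∷ π) → Valley (suc j) (a ∷ b ∷ π)

  -- The number of descents can be read off the list, which later separates the path sets of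
  -- different permutations.
  valley-unique : ∀ {i j π} → Valley i π → Valley j π → i ≡ j
  valley-unique (ascent _)        (ascent _)        = refl
  valley-unique (ascent (a<b ∷ _)) (descent b<a _)  = contradiction a<b (Fin.<-asym b<a)
  valley-unique (descent b<a _) (ascent (a<b ∷ _))  = contradiction a<b (Fin.<-asym b<a)
  valley-unique (descent _ v)     (descent _ v′)    = cong suc (valley-unique v v′)

  -- Two consecutive north steps cannot carry a descent, so on the diagonal each descent forces
  -- the steps N E.

  valleyPaths : ℕ → List (Fin n) → List (LabelledPath n)
  valleyPaths zero    π       = labelledBallots π 0
  valleyPaths (suc j) []      = []
  valleyPaths (suc j) (a ∷ π) = map (λ p → N a ∷ E ∷ p) (valleyPaths j π)

  -- The forced steps return to the diagonal having used `j` labels; what remains is an arbitrary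
  -- Dyck path carrying the other labels.
  length-valleyPaths : ∀ {j π} → Valley j π → length (valleyPaths j π) ≡ catalan (length π ∸ j)
  length-valleyPaths {π = π} (ascent _) =
    trans (length-labelledBallots π 0) (ballot-catalan (length π))
  length-valleyPaths {suc j} {_ ∷ π} (descent _ v) =
    trans (length-map _ (valleyPaths j π)) (length-valleyPaths v)

  valleyPaths-unique : ∀ j π → Unique (valleyPaths j π)
  valleyPaths-unique zero    π       = labelledBallots-unique π 0
  valleyPaths-unique (suc j) []      = []
  valleyPaths-unique (suc j) (a ∷ π) =
    Unique.map⁺ (∷-injectiveʳ ∘ ∷-injectiveʳ) (valleyPaths-unique j π)

  ∈-valleyPaths⁺ : ∀ {j} p → Valley j (φ p) → Ballot 0 (map forget p) →
                   Linked NorthLabelsIncrease p → p ∈ valleyPaths j (φ p)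
  ∈-valleyPaths⁺ {zero}  p               v             b _ = ∈-labelledBallots⁺ p 0 b
  ∈-valleyPaths⁺ {suc j} (N a ∷ N c ∷ p) (descent c<a _) b (a<c ∷ _) =
    contradiction a<c (Fin.<-asym c<a)
  ∈-valleyPaths⁺ {suc j} (N a ∷ E ∷ p)   v             b (_ ∷ columns) =
    ∈-map⁺ _ (∈-valleyPaths⁺ p (rest v) b (Linked.tail columns))
    where
    rest : ∀ {j a π} → Valley (suc j) (a ∷ π) → Valley j π
    rest (descent _ v) = v

  ∈-valleyPaths⁻ : ∀ {j π p} → Valley j π → p ∈ valleyPaths j π →
                   φ p ≡ π × Ballot 0 (map forget p) × Linked NorthLabelsIncrease p
  ∈-valleyPaths⁻ {p = p} (ascent {a} {π} inc) p∈ with ∈-labelledBallots⁻ (a ∷ π) 0 p∈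
  ... | φp≡ , b = φp≡ , b , increasing⇒columns p (subst (Linked Fin._<_) (sym φp≡) inc)
  ∈-valleyPaths⁻ (descent _ v) p∈ with _ , q∈ , refl ← ∈-map⁻ _ p∈
    with φq≡ , b , columns ← ∈-valleyPaths⁻ v q∈ = cong (_ ∷_) φq≡ , b , tt ∷ linked-E∷ columns

-- Relations on pairs and triples of list entries

-- This serves both to identify a complete increasing list with `allFin n` and to count the filtered
-- parking functions by an explicit enumeration.
unique∧set⇒↭ : ∀ {A : Set} {xs ys : List A} → Unique xs → Unique ys →
               (∀ {x} → x ∈ xs → x ∈ ys) → (∀ {x} → x ∈ ys → x ∈ xs) → xs ↭ ys
unique∧set⇒↭ xs! ys! xs⊆ys ys⊆xs = ∼bag⇒↭ (unique∧set⇒bag xs! ys! (mk⇔ xs⊆ys ys⊆xs))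

module _ {A : Set} {R : Rel A 0ℓ} where

  allPairs-reverse : ∀ {xs} → AllPairs (flip R) xs → AllPairs R (reverse xs)
  allPairs-reverse []                       = []
  allPairs-reverse {x ∷ xs} (x~xs ∷ xs~)    = subst (AllPairs R) (sym (unfold-reverse x xs))
    (AllPairs.++⁺ (allPairs-reverse xs~) ([] ∷ [])
      (All.map (_∷ []) (All-resp-↭ (↭-sym (↭-reverse xs)) x~xs)))

  allPairs-++⁻ : ∀ xs {ys} → AllPairs R (xs ++ ys) →
        AllPairs R xs × AllPairs R ys × All (λ x → All (R x) ys) xs
  allPairs-++⁻ []       ys~         = [] , ys~ , []
  allPairs-++⁻ (x ∷ xs) (x~ ∷ xys~) =
    let xs~ , ys~ , xs~ys = allPairs-++⁻ xs xys~
    in All.++⁻ˡ xs x~ ∷ xs~ , ys~ , All.++⁻ʳ xs x~ ∷ xs~ys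

  allPairs-tabulate : ∀ {xs} → (∀ {i j} → i Fin.< j → R (lookup xs i) (lookup xs j)) → AllPairs R xs
  allPairs-tabulate {xs} f = subst (AllPairs R) (tabulate-lookup xs) (AllPairs.tabulate⁺-< f)

  allPairs-lookup : ∀ {xs} → AllPairs R xs → ∀ {i j} → i Fin.< j → R (lookup xs i) (lookup xs j)
  allPairs-lookup {xs = _ ∷ xs} (x~ ∷ _)   {Fin.zero}  {Fin.suc j} _   = All.lookup x~ (∈-lookup j)
  allPairs-lookup {xs = _ ∷ xs} (_  ∷ xs~) {Fin.suc i} {Fin.suc j} i<j = allPairs-lookup xs~ (s<s⁻¹ i<j)

module _ {A : Set} where

  -- The analogue of `AllPairs` for three positions from left to right. It turns avoidance of a
  -- pattern of length three into a condition suited to induction on the list.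
  data AllTriples (R : A → A → A → Set) : List A → Set where
    []  : AllTriples R []
    _∷_ : ∀ {x xs} → AllPairs (R x) xs → AllTriples R xs → AllTriples R (x ∷ xs)

  triples-tabulate : ∀ {R} xs →
    (∀ {i j k} → i Fin.< j → j Fin.< k → R (lookup xs i) (lookup xs j) (lookup xs k)) → AllTriples R xs
  triples-tabulate []       f = []
  triples-tabulate (x ∷ xs) f =
    allPairs-tabulate (λ i<j → f {Fin.zero} z<s (s<s i<j)) ∷
    triples-tabulate xs (λ i<j j<k → f (s<s i<j) (s<s j<k))

  triples-lookup : ∀ {R xs} → AllTriples R xs →
    ∀ {i j k} → i Fin.< j → j Fin.< k → R (lookup xs i) (lookup xs j) (lookup xs k)
  triples-lookup (x~ ∷ _) {Fin.zero}  {Fin.suc j} {Fin.suc k} _ j<k = allPairs-lookup x~ (s<s⁻¹ j<k)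
  triples-lookup (_ ∷ t)  {Fin.suc i} {Fin.suc j} {Fin.suc k} i<j j<k =
    triples-lookup t (s<s⁻¹ i<j) (s<s⁻¹ j<k)

  triples-zip : ∀ {R S T : A → A → A → Set} {xs} →
    AllTriples R xs → AllTriples S xs → AllTriples T xs →
    AllTriples (λ a b c → R a b c × S a b c × T a b c) xs
  triples-zip []      []      []      = []
  triples-zip (r ∷ rs) (s ∷ ss) (t ∷ ts) = AllPairs.zip (r , AllPairs.zip (s , t)) ∷ triples-zip rs ss ts

  triples-map : ∀ {R S : A → A → A → Set} → (∀ {a b c} → R a b c → S a b c) →
                ∀ {xs} → AllTriples R xs → AllTriples S xs
  triples-map f []       = []
  triples-map f (r ∷ rs) = AllPairs.map f r ∷ triples-map f rs

  allPairs-zipWithAll : ∀ {P : Pred A 0ℓ} {Q R : Rel A 0ℓ} → (∀ {x y} → P x → P y → Q x y → R x y) →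
            ∀ {xs} → All P xs → AllPairs Q xs → AllPairs R xs
  allPairs-zipWithAll f []         []         = []
  allPairs-zipWithAll f (px ∷ pxs) (qx ∷ qxs) =
    All.zipWith (uncurry (f px)) (pxs , qx) ∷ allPairs-zipWithAll f pxs qxs

  -- A triple has three, two, one or none of its entries in `xs`, and the four hypotheses treat
  -- these cases in turn; `D` holds within `xs`, `U` within `ys` and `X` across.
  triples-++ : ∀ {D U X : Rel A 0ℓ} {R : A → A → A → Set} →
    (∀ {a b c} → D a b → D a c → D b c → R a b c) →
    (∀ {a b c} → D a b → X a c → X b c → R a b c) →
    (∀ {a b c} → X a b → X a c → U b c → R a b c) →
    (∀ {a b c} → U a b → U a c → U b c → R a b c) →
    ∀ {xs ys} → AllPairs D xs → AllPairs U ys → All (λ x → All (X x) ys) xs →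
    AllTriples R (xs ++ ys)
  triples-++ ddd ddu duu uuu []         []         []           = []
  triples-++ ddd ddu duu uuu []         (u ∷ us)   []           =
    allPairs-zipWithAll uuu u us ∷ triples-++ ddd ddu duu uuu [] us []
  triples-++ {X = X} ddd ddu duu uuu (d ∷ ds) us (x ∷ xs) =
    AllPairs.++⁺ (allPairs-zipWithAll ddd d ds) (allPairs-zipWithAll duu x us)
      (All.zipWith (λ (dab , xb) → All.zipWith (uncurry (ddu dab)) (x , xb)) (d , xs))
    ∷ triples-++ ddd ddu duu uuu ds us xs


-- Patterns of length three

module _ {n : ℕ} where

  -- σ is the inverse of the pattern: its smallest entry is at position σ 0F, and so on.

  NotOrderedBy : (Fin 3 → Fin 3) → Fin n → Fin n → Fin n → Set
  NotOrderedBy σ a b c = ¬ (v (σ 0F) Fin.< v (σ 1F) × v (σ 1F) Fin.< v (σ 2F))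
    where
    v : Fin 3 → Fin n
    v = Vec.lookup (a ∷ b ∷ c ∷ [])

  module _ (ρ₀ ρ₁ ρ₂ : Fin 3) (σ : Fin 3 → Fin 3)
    (σ∘ρ : ∀ a → σ (lookup (ρ₀ ∷ ρ₁ ∷ ρ₂ ∷ []) a) ≡ a)
    (ρ∘σ : ∀ b → lookup (ρ₀ ∷ ρ₁ ∷ ρ₂ ∷ []) (σ b) ≡ b)
    (π : List (Fin n)) where

    private
      ρ : List (Fin 3)
      ρ = ρ₀ ∷ ρ₁ ∷ ρ₂ ∷ []

    -- Two strict comparisons between values of neighbouring rank suffice, since transitivity
    -- supplies the third.
    occurrence⁺ : ∀ {i j k} → i Fin.< j → j Fin.< k →
      (let v = Vec.lookup (Vec.map (lookup π) (i ∷ j ∷ k ∷ [])) in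
       v (σ 0F) Fin.< v (σ 1F) × v (σ 1F) Fin.< v (σ 2F)) →
      IsOccurrence π ρ (i ∷ j ∷ k ∷ [])
    occurrence⁺ {i} {j} {k} i<j j<k (v₀<v₁ , v₁<v₂) = occurrence increasing sameOrder
      where
      is : Vec (Fin (length π)) 3
      is = i ∷ j ∷ k ∷ []

      increasing : ∀ a b → a Fin.< b → Vec.lookup is a Fin.< Vec.lookup is b
      increasing 0F 1F _ = i<j
      increasing 0F 2F _ = <-trans i<j j<k
      increasing 1F 2F _ = j<k
      increasing 1F 1F (s<s ())
      increasing 2F 1F (s<s ())
      increasing 2F 2F (s<s (s<s ()))

      -- The entries of the triple listed by rank instead of position.
      w : Fin 3 → Fin n
      w b = lookup π (Vec.lookup is (σ b))

      w-lookup : ∀ b → Vec.lookup (Vec.map (lookup π) is) (σ b) ≡ w b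
      w-lookup b = lookup-map (σ b) (lookup π) is

      w₀<w₁ : w 0F Fin.< w 1F
      w₀<w₁ = subst₂ Fin._<_ (w-lookup 0F) (w-lookup 1F) v₀<v₁

      w₁<w₂ : w 1F Fin.< w 2F
      w₁<w₂ = subst₂ Fin._<_ (w-lookup 1F) (w-lookup 2F) v₁<v₂

      w-mono : ∀ b c → b Fin.< c → w b Fin.< w c
      w-mono 0F 1F _ = w₀<w₁
      w-mono 0F 2F _ = <-trans w₀<w₁ w₁<w₂
      w-mono 1F 2F _ = w₁<w₂
      w-mono 1F 1F (s<s ())
      w-mono 2F 1F (s<s ())
      w-mono 2F 2F (s<s (s<s ()))

      w∘ρ : ∀ a → w (lookup ρ a) ≡ lookup π (Vec.lookup is a)
      w∘ρ a = cong (lookup π ∘ Vec.lookup is) (σ∘ρ a)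

      sameOrder : ∀ a b → _
      -- A strictly increasing `w` both preserves and reflects `≤`, and `w∘ρ` turns ranks back into
      -- positions.
      sameOrder a b = subst₂ (λ x y → x Fin.≤ y ⇔ lookup ρ a Fin.≤ lookup ρ b) (w∘ρ a) (w∘ρ b)
        (mk⇔ (λ wa≤wb → ≮⇒≥ λ b<a → <⇒≱ (w-mono _ _ b<a) wa≤wb)
             (λ a≤b → [ <⇒≤ ∘ w-mono _ _ , ≤-reflexive ∘ cong (Fin.toℕ ∘ w) ∘ Fin.toℕ-injective ]′
                        (m≤n⇒m<n∨m≡n a≤b)))

    avoids⇒triples : ¬ ∃ (IsOccurrence π ρ) → AllTriples (NotOrderedBy σ) π
    avoids⇒triples avoids = triples-tabulate π λ i<j j<k ordered →
      avoids (_ , occurrence⁺ i<j j<k ordered)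

    triples⇒avoids : AllTriples (NotOrderedBy σ) π → ¬ ∃ (IsOccurrence π ρ)
    triples⇒avoids triples (is@(i ∷ j ∷ k ∷ []) , occurrence increasing sameOrder) =
      triples-lookup triples (increasing 0F 1F z<s) (increasing 1F 2F (s<s z<s))
        (ordered 0F 1F z<s , ordered 1F 2F (s<s z<s))
      where
      v : Fin 3 → Fin n
      v = Vec.lookup (Vec.map (lookup π) is)

      ordered : ∀ b c → b Fin.< c → v (σ b) Fin.< v (σ c)
      ordered b c b<c = subst₂ Fin._<_
        (sym (lookup-map (σ b) (lookup π) is)) (sym (lookup-map (σ c) (lookup π) is))
        -- `sameOrder` speaks of `≤` only, so the strict comparison comes by contraposition.
        (≰⇒> λ c≤b → <⇒≱ b<c
          (subst₂ Fin._≤_ (ρ∘σ c) (ρ∘σ b) (Equivalence.to (sameOrder (σ c) (σ b)) c≤b)))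

  -- For a concrete pattern both inverse laws are settled by evaluation.
  pattern⇔ : ∀ ρ₀ ρ₁ ρ₂ (σ : Fin 3 → Fin 3) → let ρ = ρ₀ ∷ ρ₁ ∷ ρ₂ ∷ [] in
    {True (Fin.all? λ a → σ (lookup ρ a) Fin.≟ a)} →
    {True (Fin.all? λ b → lookup ρ (σ b) Fin.≟ b)} →
    ∀ {π} → (¬ ∃ (IsOccurrence π ρ)) ⇔ AllTriples (NotOrderedBy σ) π
  pattern⇔ ρ₀ ρ₁ ρ₂ σ {σ∘ρ} {ρ∘σ} {π} = mk⇔
    (avoids⇒triples ρ₀ ρ₁ ρ₂ σ (toWitness σ∘ρ) (toWitness ρ∘σ) π)
    (triples⇒avoids ρ₀ ρ₁ ρ₂ σ (toWitness σ∘ρ) (toWitness ρ∘σ) π)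

  [132]⇔ : ∀ {π : List (Fin n)} → Avoids π [132] ⇔ AllTriples (λ a b c → ¬ (a Fin.< c × c Fin.< b)) π
  [132]⇔ = pattern⇔ 0F 2F 1F (lookup (0F ∷ 2F ∷ 1F ∷ []))

  [213]⇔ : ∀ {π : List (Fin n)} → Avoids π [213] ⇔ AllTriples (λ a b c → ¬ (b Fin.< a × a Fin.< c)) π
  [213]⇔ = pattern⇔ 1F 0F 2F (lookup (1F ∷ 0F ∷ 2F ∷ []))

  -- While 132 and 213 are their own inverses, 231 and 312 are inverse to each other, so each is
  -- given with the other as `σ`.
  [231]⇔ : ∀ {π : List (Fin n)} → Avoids π [231] ⇔ AllTriples (λ a b c → ¬ (c Fin.< a × a Fin.< b)) π
  [231]⇔ = pattern⇔ 1F 2F 0F (lookup (2F ∷ 0F ∷ 1F ∷ []))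

  [312]⇔ : ∀ {π : List (Fin n)} → Avoids π [312] ⇔ AllTriples (λ a b c → ¬ (b Fin.< c × c Fin.< a)) π
  [312]⇔ = pattern⇔ 2F 0F 1F (lookup (1F ∷ 2F ∷ 0F ∷ []))

-- The structure of the two classes of permutations

module _ {n : ℕ} where

  Skewed Layered : Fin n → Fin n → Fin n → Set
  Skewed  a b c = ¬ (a Fin.< c × c Fin.< b) × ¬ (b Fin.< a × a Fin.< c) × ¬ (c Fin.< a × a Fin.< b)
  Layered a b c = ¬ (a Fin.< c × c Fin.< b) × ¬ (c Fin.< a × a Fin.< b) × ¬ (b Fin.< c × c Fin.< a)

  skewed⇔ : ∀ {π : List (Fin n)} →
    All (Avoids π) ([132] ∷ [213] ∷ [231] ∷ []) ⇔ AllTriples Skewed π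
  skewed⇔ = mk⇔
    (λ { (p ∷ q ∷ r ∷ []) → triples-zip (to [132]⇔ p) (to [213]⇔ q) (to [231]⇔ r) })
    (λ t → from [132]⇔ (triples-map proj₁ t) ∷ from [213]⇔ (triples-map (proj₁ ∘ proj₂) t)
         ∷ from [231]⇔ (triples-map (proj₂ ∘ proj₂) t) ∷ [])
    where open Equivalence

  layered⇔ : ∀ {π : List (Fin n)} →
    All (Avoids π) ([132] ∷ [231] ∷ [312] ∷ []) ⇔ AllTriples Layered π
  layered⇔ = mk⇔
    (λ { (p ∷ q ∷ r ∷ []) → triples-zip (to [132]⇔ p) (to [231]⇔ q) (to [312]⇔ r) })
    (λ t → from [132]⇔ (triples-map proj₁ t) ∷ from [231]⇔ (triples-map (proj₁ ∘ proj₂) t)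
         ∷ from [312]⇔ (triples-map (proj₂ ∘ proj₂) t) ∷ [])
    where open Equivalence

  Increasing Decreasing : List (Fin n) → Set
  Increasing = AllPairs Fin._<_
  Decreasing = AllPairs Fin._>_

  ≮∧≢⇒> : ∀ {a b : Fin n} → ¬ a Fin.< b → a ≢ b → b Fin.< a
  ≮∧≢⇒> a≮b a≢b = Fin.≤∧≢⇒< (≮⇒≥ a≮b) (a≢b ∘ sym)

  -- A sorted list is determined by its entries with multiplicity, and strict increase excludes
  -- repetitions.
  increasing∧complete⇒allFin : ∀ {xs} → Increasing xs → (∀ i → i ∈ xs) → xs ≡ allFin n
  increasing∧complete⇒allFin {xs} xs↗ complete = Pointwise-≡⇒≡
    (↗↭↗⇒≋ (Fin.≤-totalOrder n) (sorted xs↗) (sorted (AllPairs.tabulate⁺-< λ i<j → i<j))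
      (↭⇒↭ₛ (unique∧set⇒↭ (AllPairs.map Fin.<⇒≢ xs↗) (Unique.allFin⁺ n)
        (λ _ → ∈-allFin _) (λ _ → complete _))))
    where
    sorted : ∀ {xs} → Increasing xs → Linked Fin._≤_ xs
    sorted = AllPairs⇒Linked ∘ AllPairs.map <⇒≤

  -- Each entry of `ds` is followed by a smaller one, the last by `a`, so it accounts for exactly
  -- one descent.
  valley-++ : ∀ {ds a as} → Decreasing ds → Increasing (a ∷ as) → All (a Fin.<_) ds →
              Valley (length ds) (ds ++ a ∷ as)
  valley-++ {[]}         _                as _         = ascent (AllPairs⇒Linked as)
  valley-++ {d ∷ []}     _                as (a<d ∷ _) = descent a<d (ascent (AllPairs⇒Linked as))
  valley-++ {d ∷ e ∷ ds} ((e<d ∷ _) ∷ ds↘) as (_ ∷ a<ds) = descent e<d (valley-++ ds↘ as a<ds)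

  private
    variable
      a x  : Fin n
      as vs xs π : List (Fin n)

  skew layer : List (Fin n) → List (Fin n) → List (Fin n)
  skew  us vs = reverse vs ++ us
  layer us vs = reverse us ++ vs

  skew-↭ : ∀ us vs → skew us vs ↭ us ++ vs
  skew-↭ us vs = ↭-trans (++⁺ʳ us (↭-reverse vs)) (++-comm vs us)

  layer-↭ : ∀ us vs → layer us vs ↭ us ++ vs
  layer-↭ us vs = ++⁺ʳ vs (↭-reverse us)

  skew-valley : ∀ vs → Increasing ((a ∷ as) ++ vs) → Valley (length vs) (skew (a ∷ as) vs)
  skew-valley {a} {as} vs inc with us↗ , vs↗ , (a<vs ∷ _) ← allPairs-++⁻ (a ∷ as) inc =
    subst (λ j → Valley j (skew (a ∷ as) vs)) (length-reverse vs)
      (valley-++ (allPairs-reverse vs↗) us↗ (All-resp-↭ (↭-sym (↭-reverse vs)) a<vs))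

  -- Reversal puts the minimum `a` last in its block, where it begins the ascent; only the entries
  -- of `as` give descents.
  layer-valley : ∀ vs → Increasing ((a ∷ as) ++ vs) → Valley (length as) (layer (a ∷ as) vs)
  layer-valley {a} {as} vs inc with (a<as ∷ as↗) , vs↗ , (a<vs ∷ _) ← allPairs-++⁻ (a ∷ as) inc =
    subst₂ Valley (length-reverse as)
      (sym (trans (cong (_++ vs) (unfold-reverse a as)) (∷ʳ-++ (reverse as) a vs)))
      (valley-++ (allPairs-reverse as↗) (a<vs ∷ vs↗) (All-resp-↭ (↭-sym (↭-reverse as)) a<as))

  -- A triple starting in `reverse vs` has its largest entry first, as in none of the three
  -- patterns. A triple within `us` increases.
  skew-skewed : ∀ us vs → Increasing (us ++ vs) → AllTriples Skewed (skew us vs)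
  skew-skewed us vs inc with us↗ , vs↗ , us<vs ← allPairs-++⁻ us inc =
    triples-++ {X = Fin._>_}
      (λ b<a c<a _ → above b<a c<a) (λ b<a c<a _ → above b<a c<a) (λ b<a c<a _ → above b<a c<a)
      (λ a<b a<c b<c → (λ (_ , c<b) → Fin.<-asym b<c c<b) ,
                       (λ (b<a , _) → Fin.<-asym a<b b<a) ,
                       (λ (c<a , _) → Fin.<-asym a<c c<a))
      (allPairs-reverse vs↗) us↗ (All-resp-↭ (↭-sym (↭-reverse vs)) (All.All-swap us<vs))
    where
    above : ∀ {a b c : Fin n} → b Fin.< a → c Fin.< a → Skewed a b c
    above b<a c<a = (λ (a<c , _) → Fin.<-asym c<a a<c) ,
                    (λ (_ , a<c) → Fin.<-asym c<a a<c) ,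
                    (λ (_ , a<b) → Fin.<-asym b<a a<b)

  -- A triple within `reverse us` decreases. Any other has its largest entry last, as in none of the
  -- three patterns.
  layer-layered : ∀ us vs → Increasing (us ++ vs) → AllTriples Layered (layer us vs)
  layer-layered us vs inc with us↗ , vs↗ , us<vs ← allPairs-++⁻ us inc =
    triples-++ {X = Fin._<_}
      (λ b<a c<a c<b → (λ (a<c , _) → Fin.<-asym c<a a<c) ,
                       (λ (_ , a<b) → Fin.<-asym b<a a<b) ,
                       (λ (b<c , _) → Fin.<-asym c<b b<c))
      (λ b<a a<c b<c → (λ (_ , c<b) → Fin.<-asym b<c c<b) , below a<c)
      (λ _ a<c b<c → (λ (_ , c<b) → Fin.<-asym b<c c<b) , below a<c)
      (λ _ a<c b<c → (λ (_ , c<b) → Fin.<-asym b<c c<b) , below a<c)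
      (allPairs-reverse us↗) vs↗ (All-resp-↭ (↭-sym (↭-reverse us)) us<vs)
    where
    below : ∀ {a b c : Fin n} → a Fin.< c → ¬ (c Fin.< a × a Fin.< b) × ¬ (b Fin.< c × c Fin.< a)
    below a<c = (λ (c<a , _) → Fin.<-asym a<c c<a) , (λ (_ , c<a) → Fin.<-asym a<c c<a)

  -- Induction on the tail, with a new entry `x` put before `y`. Avoidance of 213 enters when the
  -- first descent appears; further entries lie above `a ∷ as` by transitivity.
  skewed-decomposition : Unique (x ∷ xs) → AllTriples Skewed (x ∷ xs) →
    ∃₂ λ a as → ∃ λ ds → x ∷ xs ≡ ds ++ a ∷ as × Decreasing ds × Increasing (a ∷ as) ×
                         All (λ d → All (Fin._< d) (a ∷ as)) ds
  skewed-decomposition {x} {[]} _ _ = x , [] , [] , refl , [] , [] ∷ [] , []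
  skewed-decomposition {x} {y ∷ zs} ((x≢y ∷ x≢zs) ∷ unique) ((xy ∷ _) ∷ triples)
    with skewed-decomposition unique triples
  ... | a , as , [] , refl , [] , a<as ∷ as↗ , [] with Fin.<-cmp x y
  ...   | tri< x<y _ _ =
          x , y ∷ zs , [] , refl , [] , (x<y ∷ All.map (<-trans x<y) a<as) ∷ a<as ∷ as↗ , []
  ...   | tri≈ _ x≡y _ = contradiction x≡y x≢y
  ...   | tri> _ _ y<x =
          y , zs , x ∷ [] , refl , [] ∷ [] , a<as ∷ as↗ , (y<x ∷ All.zipWith below (xy , x≢zs)) ∷ []
    where
    below : ∀ {z} → Skewed x y z × x ≢ z → z Fin.< x
    below ((_ , ¬213 , _) , x≢z) = ≮∧≢⇒> (λ x<z → ¬213 (y<x , x<z)) x≢z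
  skewed-decomposition {x} {y ∷ zs} ((x≢y ∷ x≢zs) ∷ unique) ((xy ∷ _) ∷ triples)
      | a , as , _ ∷ ds , refl , ds>@(y>ds ∷ _) , as↗ , ds>as@((a<y ∷ y>as) ∷ _) with Fin.<-cmp x y
  -- An ascent before a descent is impossible: `x`, `y`, `a` form 231 if `a < x` and 132 otherwise.
  ...   | tri< x<y _ _ = contradiction (All.lookup xy a∈) λ (¬132 , _ , ¬231) →
            ¬132 (≮∧≢⇒> (λ a<x → ¬231 (a<x , x<y)) (All.lookup x≢zs a∈ ∘ sym) , a<y)
    where
    a∈ : a ∈ ds ++ a ∷ as
    a∈ = ∈-++⁺ʳ ds (here refl)
  ...   | tri≈ _ x≡y _ = contradiction x≡y x≢y
  ...   | tri> _ _ y<x = a , as , x ∷ y ∷ ds , refl ,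
            (y<x ∷ All.map (flip <-trans y<x) y>ds) ∷ ds> , as↗ ,
            All.map (flip <-trans y<x) (a<y ∷ y>as) ∷ ds>as

  -- Here the minimum closes the decreasing part `x ∷ bs`. If `x < y`, then `y` was that minimum of
  -- the tail and moves over to the increasing part.
  layered-decomposition : Unique (x ∷ xs) → AllTriples Layered (x ∷ xs) →
    ∃₂ λ bs cs → xs ≡ bs ++ cs × Decreasing (x ∷ bs) × Increasing cs ×
                   All (λ b → All (b Fin.<_) cs) (x ∷ bs)
  layered-decomposition {x} {[]} _ _ = [] , [] , refl , [] ∷ [] , [] , [] ∷ []
  layered-decomposition {x} {y ∷ zs} ((x≢y ∷ x≢zs) ∷ unique) ((xy ∷ _) ∷ triples)
    with Fin.<-cmp x y | layered-decomposition unique triples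
  ... | tri≈ _ x≡y _ | _ = contradiction x≡y x≢y
  ... | tri< x<y _ _ | [] , cs , refl , _ , cs↗ , y<cs ∷ [] =
          [] , y ∷ cs , refl , [] ∷ [] , y<cs ∷ cs↗ , (x<y ∷ All.map (<-trans x<y) y<cs) ∷ []
  -- Again an ascent before a descent: `x`, `y`, `z` form 231 or 132.
  ... | tri< x<y _ _ | z ∷ bs , cs , refl , (z<y ∷ _) ∷ _ , _ , _ =
          contradiction (All.head xy) λ (¬132 , ¬231 , _) →
            ¬132 (≮∧≢⇒> (λ z<x → ¬231 (z<x , x<y)) (All.head x≢zs ∘ sym) , z<y)
  ... | tri> _ _ y<x | bs , cs , refl , y>bs ∷ bs↘ , cs↗ , y<cs ∷ bs<cs =
          y ∷ bs , cs , refl , (y<x ∷ All.map (flip <-trans y<x) y>bs) ∷ y>bs ∷ bs↘ , cs↗ ,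
          All.zipWith above (All.zip (All.++⁻ʳ bs xy , All.++⁻ʳ bs x≢zs) , y<cs) ∷ y<cs ∷ bs<cs
    where
    above : ∀ {c} → (Layered x y c × x ≢ c) × y Fin.< c → x Fin.< c
    -- An entry `c` between `y` and `x` in value would complete 312.
    above (((_ , _ , ¬312) , x≢c) , y<c) = ≮∧≢⇒> (λ c<x → ¬312 (y<c , c<x)) (x≢c ∘ sym)

  skewed⇒skew : 1 ≤ n → IsPermutation π → AllTriples Skewed π →
    ∃₂ λ us vs → us ++ vs ≡ allFin n × 0 < length us × π ≡ skew us vs
  skewed⇒skew {[]} (s≤s _) (_ , complete) _ = case complete Fin.zero of λ ()
  skewed⇒skew {x ∷ xs} _ (unique , complete) triples
    with a , as , ds , π≡ , ds↘ , as↗ , ds>as ← skewed-decomposition unique triples =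
    a ∷ as , reverse ds ,
    increasing∧complete⇒allFin
      (AllPairs.++⁺ as↗ (allPairs-reverse ds↘)
        (All.map (All-resp-↭ (↭-sym (↭-reverse ds))) (All.All-swap ds>as)))
      (λ i → ∈-resp-↭ (↭-trans (++-comm ds (a ∷ as)) (++⁺ˡ (a ∷ as) (↭-sym (↭-reverse ds))))
        (subst (i ∈_) π≡ (complete i))) ,
    z<s ,
    trans π≡ (cong (_++ a ∷ as) (sym (reverse-involutive ds)))

  layered⇒layer : 1 ≤ n → IsPermutation π → AllTriples Layered π →
    ∃₂ λ us vs → us ++ vs ≡ allFin n × 0 < length us × π ≡ layer us vs
  layered⇒layer {[]} (s≤s _) (_ , complete) _ = case complete Fin.zero of λ ()
  layered⇒layer {x ∷ xs} _ (unique , complete) triples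
    with bs , cs , refl , bs↘ , cs↗ , bs<cs ← layered-decomposition unique triples =
    reverse (x ∷ bs) , cs ,
    increasing∧complete⇒allFin
      (AllPairs.++⁺ (allPairs-reverse bs↘) cs↗ (All-resp-↭ (↭-sym (↭-reverse (x ∷ bs))) bs<cs))
      (λ i → ∈-resp-↭ (++⁺ʳ cs (↭-sym (↭-reverse (x ∷ bs)))) (complete i)) ,
    subst (0 <_) (sym (length-reverse (x ∷ bs))) z<s ,
    cong (_++ cs) (sym (reverse-involutive (x ∷ bs)))

-- Enumeration of parking functions

length-concat-applyUpTo : ∀ {A : Set} (f : ℕ → List A) {g} n → (∀ {i} → i < n → length (f i) ≡ g i) →
                          length (concat (applyUpTo f n)) ≡ sum (applyUpTo g n)
length-concat-applyUpTo f zero    _  = refl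
length-concat-applyUpTo f (suc n) eq =
  trans (length-++ (f 0)) (cong₂ _+_ (eq z<s) (length-concat-applyUpTo (f ∘ suc) n (eq ∘ s<s)))

words-unique : ∀ {A : Set} {as : List A} → Unique as → ∀ k → Unique (words as k)
words-unique as! zero    = [] ∷ []
words-unique as! (suc k) =
  Unique.cartesianProductWith⁺ _∷_ (λ { refl → refl , refl }) as! (words-unique as! k)

∈-words : ∀ {A : Set} {as : List A} → (∀ a → a ∈ as) → ∀ w → w ∈ words as (length w)
∈-words complete []      = here refl
∈-words complete (a ∷ w) = ∈-cartesianProductWith⁺ _∷_ (complete a) (∈-words complete w)

labelledSteps-unique : ∀ n → Unique (labelledSteps n)
labelledSteps-unique n =
  All.map⁺ (All.universal (λ _ ()) (allFin n)) ∷ Unique.map⁺ (λ { refl → refl }) (Unique.allFin⁺ n)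

∈-labelledSteps : ∀ {n} (s : LabelledStep n) → s ∈ labelledSteps n
∈-labelledSteps (N i) = there (∈-map⁺ N (∈-allFin i))
∈-labelledSteps E     = here refl

length-endpoint : ∀ {n} (p : LabelledPath n) → let x , y = endpoint (map forget p) in length p ≡ x + y
length-endpoint []        = refl
length-endpoint (N _ ∷ p) = trans (cong suc (length-endpoint p)) (sym (+-suc _ _))
length-endpoint (E ∷ p)   = cong suc (length-endpoint p)

isParkingFunction⇒∈ : ∀ {n p} → IsParkingFunction n p → p ∈ parkingFunctions n
isParkingFunction⇒∈ {n} {p} pf@(parkingFunction (end , _) _ _) =
  ∈-filter⁺ (isParkingFunction? n)
    (subst (λ k → p ∈ words (labelledSteps n) k)
      (trans (length-endpoint p) (cong (λ (x , y) → x + y) end))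
      (∈-words ∈-labelledSteps p))
    pf

∈⇒isParkingFunction : ∀ {n p} → p ∈ parkingFunctions n → IsParkingFunction n p
∈⇒isParkingFunction {n} p∈ =
  proj₂ (∈-filter⁻ (isParkingFunction? n) {xs = words (labelledSteps n) (n + n)} p∈)

↭-allFin⇒isPermutation : ∀ {n} {π : List (Fin n)} → π ↭ allFin n → IsPermutation π
↭-allFin⇒isPermutation {n} π↭ =
  Permutationₛ.Unique-resp-↭ (setoid (Fin n)) (↭⇒↭ₛ (↭-sym π↭)) (Unique.allFin⁺ n) ,
  λ i → ∈-resp-↭ (↭-sym π↭) (∈-allFin i)

length-permutation : ∀ {n} {π : List (Fin n)} → π ↭ allFin n → length π ≡ n
length-permutation {n} π↭ = trans (↭-length π↭) (length-tabulate {n = n} (λ i → i))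

-- Counting with one permutation for each number of descents

module _ {n ρs} {f : ℕ → List (Fin n)}
  (valley : ∀ {i} → i < n → Valley (n ∸ suc i) (f i))
  (permutation : ∀ {i} → i < n → f i ↭ allFin n)
  (avoids : ∀ {i} → i < n → All (Avoids (f i)) ρs)
  (exhaustive : ∀ {π} → IsPermutation π → All (Avoids π) ρs → ∃ λ i → i < n × π ≡ f i)
  where

  private
    avoids?′ : (p : LabelledPath n) → Dec (All (Avoids (φ p)) ρs)
    avoids?′ p = All.all? (avoids? (φ p)) ρs

    paths : ℕ → List (LabelledPath n)
    paths i = valleyPaths (n ∸ suc i) (f i)

    -- With `n - 1 - i` descents, `i + 1` labels remain for the free Dyck path, so `i` runs in step
    -- with the sum of Catalan numbers.
    length-paths : ∀ {i} → i < n → length (paths i) ≡ catalan (suc i)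
    length-paths {i} i<n = trans (length-valleyPaths (valley i<n))
      (cong catalan (trans
        (cong (_∸ (n ∸ suc i)) (length-permutation (permutation i<n))) (m∸[m∸n]≡n i<n)))

    -- A common path would have a label sequence with two different numbers of descents.
    paths-disjoint : ∀ {i j} → i < j → j < n → Disjoint (paths i) (paths j)
    paths-disjoint {i} {j} i<j j<n (p∈i , p∈j) =
      <⇒≢ (∸-monoʳ-< (s<s i<j) j<n)
        (valley-unique (valley j<n) (subst (Valley (n ∸ suc i))
          (trans (sym (proj₁ (∈-valleyPaths⁻ vᵢ p∈i))) (proj₁ (∈-valleyPaths⁻ (valley j<n) p∈j))) vᵢ))
      where
      vᵢ : Valley (n ∸ suc i) (f i)
      vᵢ = valley (<-trans i<j j<n)

    sound : ∀ {i p} → i < n → p ∈ paths i → p ∈ filter avoids?′ (parkingFunctions n)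
    sound {i} {p} i<n p∈ with φp≡ , b , columns ← ∈-valleyPaths⁻ (valley i<n) p∈ =
      ∈-filter⁺ avoids?′ (isParkingFunction⇒∈ (parkingFunction (end , above) bijective columns))
        (subst (λ π → All (Avoids π) ρs) (sym φp≡) (avoids i<n))
      where
      w : Path
      w = map forget p

      above : All (WeaklyAboveDiagonal ∘ endpoint) (inits w)
      above = proj₂ (Ballot⇒aboveDiagonal 0 w b)

      φp↭ : φ p ↭ allFin n
      φp↭ = subst (_↭ allFin n) (sym φp≡) (permutation i<n)

      bijective : IsPermutation (φ p)
      bijective = ↭-allFin⇒isPermutation φp↭

      y≡n : proj₂ (endpoint w) ≡ n
      y≡n = trans (norths p) (length-permutation φp↭)

      -- The ballot condition only makes the coordinates equal; the number of labels fixes their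
      -- value.
      end : endpoint w ≡ (n , n)
      end = cong₂ _,_ (trans (proj₁ (Ballot⇒aboveDiagonal 0 w b)) y≡n) y≡n

    complete : ∀ {p} → p ∈ filter avoids?′ (parkingFunctions n) → ∃ λ i → i < n × p ∈ paths i
    complete {p} p∈
      with p∈pf , avoiding ← ∈-filter⁻ avoids?′ {xs = parkingFunctions n} p∈
      with parkingFunction (end , above) bijective columns ← ∈⇒isParkingFunction p∈pf
      with i , i<n , φp≡ ← exhaustive bijective avoiding =
      i , i<n , subst (λ π → p ∈ valleyPaths (n ∸ suc i) π) φp≡
        (∈-valleyPaths⁺ p (subst (Valley _) (sym φp≡) (valley i<n))
          (aboveDiagonal⇒Ballot 0 (map forget p) (trans (cong proj₁ end) (sym (cong proj₂ end))) above)
          columns)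

  -- The filtered parking functions and the concatenated path lists have the same members and no
  -- repetitions, hence the same length.
  pf≡∑catalan : pf n ρs ≡ ∑[1⋯ n ] catalan
  pf≡∑catalan = trans
    (↭-length (unique∧set⇒↭
      (Unique.filter⁺ avoids?′ (Unique.filter⁺ (isParkingFunction? n)
        (words-unique (labelledSteps-unique n) (n + n))))
      (Unique.concat⁺
        (All.applyUpTo⁺₁ paths n λ {i} _ → valleyPaths-unique (n ∸ suc i) (f i))
        (AllPairs.applyUpTo⁺₁ paths n paths-disjoint))
      (λ p∈ → let i , i<n , p∈i = complete p∈ in ∈-concat⁺′ p∈i (∈-applyUpTo⁺ paths i<n))
      λ p∈ → let ps , p∈ps , ps∈ = ∈-concat⁻′ (applyUpTo paths n) p∈
                 i , i<n , ps≡ = ∈-applyUpTo⁻ paths ps∈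
             in sound i<n (subst (_ ∈_) ps≡ p∈ps)))
    (length-concat-applyUpTo paths n length-paths)

-- The two families and their counts

module _ {A : Set} where

  take-suc-∷ : ∀ {k} {xs : List A} → k < length xs →
               ∃₂ λ a as → take (suc k) xs ≡ a ∷ as × length as ≡ k
  take-suc-∷ {k} {x ∷ xs} k<n =
    x , take k xs , refl , trans (length-take k xs) (m≤n⇒m⊓n≡m (s≤s⁻¹ k<n))

  take-length-++ : ∀ (us : List A) {vs} → take (length us) (us ++ vs) ≡ us
  take-length-++ []       = refl
  take-length-++ (u ∷ us) = cong (u ∷_) (take-length-++ us)

  drop-length-++ : ∀ (us : List A) {vs} → drop (length us) (us ++ vs) ≡ vs
  drop-length-++ []       = refl
  drop-length-++ (u ∷ us) = drop-length-++ us

module _ {n : ℕ} where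

  private
    start end : ℕ → List (Fin n)
    start m = take m (allFin n)
    end   m = drop m (allFin n)

    length-allFin : length (allFin n) ≡ n
    length-allFin = length-tabulate {n = n} (λ i → i)

    start++end : ∀ m → start m ++ end m ≡ allFin n
    start++end m = take++drop≡id m (allFin n)

    increasing : ∀ m → Increasing (start m ++ end m)
    increasing m = subst Increasing (sym (start++end m)) (AllPairs.tabulate⁺-< λ i<j → i<j)

    start-∷ : ∀ {k} → k < n → ∃₂ λ a as → start (suc k) ≡ a ∷ as × length as ≡ k
    start-∷ k<n = take-suc-∷ (subst (_ <_) (sym length-allFin) k<n)

    split : ∀ (us vs : List (Fin n)) → us ++ vs ≡ allFin n →
            us ≡ start (length us) × vs ≡ end (length us) × length us ≤ n
    split us vs eq = trans (sym (take-length-++ us)) (cong (take (length us)) eq) ,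
      trans (sym (drop-length-++ us)) (cong (drop (length us)) eq) ,
      subst (length us ≤_) (trans (sym (length-++ us)) (trans (cong length eq) length-allFin)) (m≤m+n _ _)

  -- A skew permutation has as many descents as its upper block has entries, a layered one has one
  -- fewer than its lower block. The cuts are chosen to give `n - 1 - i` in both cases.
  skews layers : ℕ → List (Fin n)
  skews i  = skew (start (suc i)) (end (suc i))
  layers i = layer (start (n ∸ i)) (end (n ∸ i))

  skews-valley : ∀ {i} → i < n → Valley (n ∸ suc i) (skews i)
  skews-valley {i} i<n with a , as , start≡ , _ ← start-∷ i<n =
    subst₂ Valley
      (trans (length-drop (suc i) (allFin n)) (cong (_∸ suc i) length-allFin))
      (cong (λ us → skew us (end (suc i))) (sym start≡))
      (skew-valley (end (suc i))
        (subst (λ us → Increasing (us ++ end (suc i))) start≡ (increasing (suc i))))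

  layers-valley : ∀ {i} → i < n → Valley (n ∸ suc i) (layers i)
  layers-valley {i} i<n with a , as , start≡ , |as|≡ ← start-∷ (∸-monoʳ-< {n} z<s i<n) =
    subst₂ Valley |as|≡ (cong (λ us → layer us (end (n ∸ i))) (sym start≡′))
      (layer-valley (end (n ∸ i))
        (subst (λ us → Increasing (us ++ end (n ∸ i))) start≡′ (increasing (n ∸ i))))
    where
    start≡′ : start (n ∸ i) ≡ a ∷ as
    -- `suc n ∸ suc i` computes to `n ∸ i`, so this rewrites `n ∸ i` as `suc (n ∸ suc i)`.
    start≡′ = trans (cong start (+-∸-assoc 1 i<n)) start≡

  pf-skewed : 1 ≤ n → pf n ([132] ∷ [213] ∷ [231] ∷ []) ≡ ∑[1⋯ n ] catalan
  pf-skewed 1≤n = pf≡∑catalan skews-valley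
    (λ {i} _ → ↭-trans (skew-↭ (start (suc i)) _) (↭-reflexive (start++end (suc i))))
    (λ {i} _ → Equivalence.from skewed⇔ (skew-skewed (start (suc i)) _ (increasing (suc i))))
    λ perm avoids → exhaustive (skewed⇒skew 1≤n perm (Equivalence.to skewed⇔ avoids))
    where
    exhaustive : ∀ {π} → (∃₂ λ us vs → us ++ vs ≡ allFin n × 0 < length us × π ≡ skew us vs) →
                 ∃ λ i → i < n × π ≡ skews i
    exhaustive (us@(_ ∷ us′) , vs , eq , _ , π≡) with us≡ , vs≡ , us≤n ← split us vs eq =
      -- The cut falls after `suc i` entries, so `i` is one less than the length of `us`, and `us≤n`
      -- is already `i < n`.
      length us′ , us≤n , trans π≡ (cong₂ skew us≡ vs≡)

  pf-layered : 1 ≤ n → pf n ([132] ∷ [231] ∷ [312] ∷ []) ≡ ∑[1⋯ n ] catalan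
  pf-layered 1≤n = pf≡∑catalan layers-valley
    (λ {i} _ → ↭-trans (layer-↭ (start (n ∸ i)) _) (↭-reflexive (start++end (n ∸ i))))
    (λ {i} _ → Equivalence.from layered⇔ (layer-layered (start (n ∸ i)) _ (increasing (n ∸ i))))
    λ perm avoids → exhaustive (layered⇒layer 1≤n perm (Equivalence.to layered⇔ avoids))
    where
    exhaustive : ∀ {π} → (∃₂ λ us vs → us ++ vs ≡ allFin n × 0 < length us × π ≡ layer us vs) →
                 ∃ λ i → i < n × π ≡ layers i
    exhaustive (us , vs , eq , 0<us , π≡) with us≡ , vs≡ , us≤n ← split us vs eq =
      -- The index `n ∸ length us` inverts `n ∸ i`; it is below `n` because `us` is non-empty.
      n ∸ length us , ∸-monoʳ-< 0<us us≤n ,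
      trans π≡ (trans (cong₂ layer us≡ vs≡)
        (cong (λ m → layer (start m) (end m)) (sym (m∸[m∸n]≡n us≤n))))

theorem12 : (n : ℕ) → 1 ≤ n →
    pf n ([132] ∷ [213] ∷ [231] ∷ []) ≡ pf n ([132] ∷ [231] ∷ [312] ∷ [])
    × pf n ([132] ∷ [231] ∷ [312] ∷ []) ≡ ∑[1⋯ n ] catalan
theorem12 n 1≤n = trans (pf-skewed 1≤n) (sym (pf-layered 1≤n)) , pf-layered 1≤n
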